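{- Let $d\geq 8$ and let $p_1,\dots,p_d$ be any distinct primes. Let $M=p_1^2\cdots p_d^2$, $M_j=M/p_j^2$, and $$B=\Big\{\sum_{j=1}^d c_jM_j:\ c_j\in\{0,1,\dots,p_j-1\}\text{ for } j=1,\dots,d\Big\}\subset\mathbb{Z}_M.$$ Then there exists a set $A\subset\mathbb{Z}_M$ with $A\oplus B=\mathbb{Z}_M$ such that there are no $u\in A$ and $i\in\{1,\dots,d\}$ with $u+F_i\subset A$, where $F_i=\{0,M/p_i,2M/p_i,\dots,(p_i-1)M/p_i\}\subset\mathbb{Z}_M$.
   Context: For $A,B\subset\mathbb{Z}_M$, $A\oplus B=\mathbb{Z}_M$ (a tiling) means every element of $\mathbb{Z}_M$ can be written uniquely as $a+b\bmod M$ with $a\in A$, $b\in B$. A tiling $A\oplus B=\mathbb{Z}_M$ with $M$ and $B$ as in the statement is called an integer cube tiling. -}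

module Defs where

open import Data.Nat using (ℕ; zero; suc; _+_; _*_; _^_; _≤_)
open import Data.Nat.Primality using (Prime)
open import Data.Fin using (Fin; toℕ) renaming (zero to fz; suc to fs)
open import Data.Fin.Properties using (_≟_)
open import Data.Integer using (ℤ; +_; _-_)
open import Data.Integer.Divisibility using (_∣_)
open import Data.Bool using (Bool; true; false)
open import Data.Product using (Σ; ∃; _×_; _,_)
open import Relation.Nullary using (¬_; yes; no)
open import Relation.Binary.PropositionalEquality using (_≡_)
open import Function.Definitions using (Injective)

∑ : ∀ {d} → (Fin d → ℕ) → ℕ
∑ {zero}  f = 0
∑ {suc d} f = f fz + ∑ (λ k → f (fs k))

∏ : ∀ {d} → (Fin d → ℕ) → ℕ
∏ {zero}  f = 1
∏ {suc d} f = f fz * ∏ (λ k → f (fs k))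

infix 4 _≡_[mod_]
_≡_[mod_] : ℕ → ℕ → ℕ → Set
a ≡ b [mod M ] = (+ M) ∣ ((+ a) - (+ b))

module Cube {d : ℕ} (p : Fin d → ℕ) where

  M : ℕ
  M = ∏ (λ j → p j ^ 2)

  -- M_j = M / p_j² = ∏_{k ≠ j} p_k²
  Mj : Fin d → ℕ
  Mj j = ∏ (λ k → f k (k ≟ j))
    where
    f : (k : Fin d) → _ → ℕ
    f k (yes _) = 1
    f k (no _)  = p k ^ 2

  M/p : Fin d → ℕ
  M/p i = Mj i * p i

  -- membership in B ⊂ ℤ_M (elements of ℤ_M represented by Fin M)
  InB : Fin M → Set
  InB b = Σ ((j : Fin d) → Fin (p j)) λ c → toℕ b ≡ ∑ (λ j → toℕ (c j) * Mj j) [mod M ]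

  Tiling : (Fin M → Bool) → Set
  Tiling A =
    ((x : Fin M) → Σ (Fin M) λ a → Σ (Fin M) λ b →
        (A a ≡ true) × InB b × (toℕ a + toℕ b ≡ toℕ x [mod M ]))
    × ((x a b a' b' : Fin M) →
        A a ≡ true → InB b → toℕ a + toℕ b ≡ toℕ x [mod M ] →
        A a' ≡ true → InB b' → toℕ a' + toℕ b' ≡ toℕ x [mod M ] →
        (a ≡ a') × (b ≡ b'))

  TranslateOfFiberIn : (Fin M → Bool) → Fin M → Fin d → Set
  TranslateOfFiberIn A u i =
    (k : Fin (p i)) (y : Fin M) →
      toℕ y ≡ toℕ u + toℕ k * M/p i [mod M ] → A y ≡ true

{-# OPTIONS --safe #-}

-- Dividing by M_j in ℤ_{p_j²} for every j identifies ℤ_M with the torus ∏ ℤ_{p_j²} and B with the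
-- box ∏ [0 , p_j).  Tilings by B become tilings of the torus by boxes, and a fiber u + F_i in A is
-- a column of boxes that closes up in direction i.  Use only corners that are 0 or 1 modulo p_j:
-- each circle ℤ_{p_j²} is cut into p_j intervals in an unshifted and in a shifted way.  Call the
-- first interval of each kind low and all the others high.  A set of words over {shift} × {level}
-- that tiles combinatorially then gives a tiling of the torus, and every closed column contains
-- two boxes whose words differ in a single level.  So a tiling by words without such twins is
-- enough, that is, a counterexample to Keller's conjecture.  In dimension 8 it is a clique of size
-- 256 in the Keller graph, as first found by Mackey; a further dimension is added by stacking two
-- layers that differ by the exchange of the two levels in one coordinate.
module Submission where

open import Defs
open import Data.Nat using (ℕ; zero; suc; _+_; _*_; _∸_; _^_; _≤_; _<_; z≤n; s≤s; NonZero; _≡ᵇ_; _≤?_; nonTrivial⇒n>1)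
open import Data.Nat.Properties hiding (_≟_; _≤?_)
open import Data.Nat.DivMod
import Data.Nat.Divisibility as ℕ
open import Data.Nat.Coprimality as Coprime using (Coprime; coprime-Bézout; coprime-divisor)
open import Data.Nat.GCD using (module Bézout)
open import Data.Nat.Primality using (Prime; prime⇒irreducible; prime⇒nonZero; prime⇒nonTrivial)
open import Data.Nat.Tactic.RingSolver using (solve-∀)
open import Data.Integer as ℤ using (∣_∣)
open import Data.Integer.Properties using (∣⊖∣-≤; ∣m⊖n∣≡∣n⊖m∣; m-n≡m⊖n)
open import Data.Bool using (Bool; true; false; not; if_then_else_; _∧_; _∨_)
import Data.Bool.Properties as Bool
open import Data.Fin using (Fin; zero; suc; toℕ; fromℕ<)
open import Data.Fin.Properties using (_≟_; toℕ<n; toℕ-fromℕ<; toℕ-injective; all?)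
open import Data.Product using (Σ; ∃; _×_; _,_; proj₁; proj₂; map₂)
import Data.Product.Properties as Product
open import Data.Sum using (inj₁; inj₂)
open import Data.List using (List; []; _∷_; _++_; length; null; filter; map; cartesianProductWith)
open import Data.List.Membership.Propositional using (_∈_)
open import Data.List.Membership.Propositional.Properties using (∈-filter⁺; ∈-filter⁻)
import Data.List.Membership.DecPropositional as Membership
open import Data.List.Relation.Unary.Any using (here; there)
open import Data.Vec as Vec using (Vec; []; _∷_; tabulate; lookup; updateAt)
open import Data.Vec.Properties using (≡-dec; lookup∘tabulate; tabulate∘lookup; tabulate-cong; lookup∘updateAt; lookup∘updateAt′)
open import Data.Vec.Relation.Binary.Pointwise.Inductive as Pointwise using (Pointwise; []; _∷_; decidable; tabulate⁺)
open import Function using (_∘_)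
open import Function.Definitions using (Injective)
open import Relation.Binary.Definitions using (DecidableEquality)
open import Relation.Binary.PropositionalEquality
open import Relation.Nullary using (¬_; Dec; yes; no; does; contradiction; ⌊_⌋)
open import Relation.Unary using (Decidable)

-- Congruences

private variable
  a b c d m n : ℕ

%-congˡ-+ : ∀ a b c m .{{_ : NonZero m}} → a % m ≡ b % m → (a + c) % m ≡ (b + c) % m
%-congˡ-+ a b c m eq = begin
  (a + c) % m          ≡⟨ %-distribˡ-+ a c m ⟩
  (a % m + c % m) % m  ≡⟨ cong (λ z → (z + c % m) % m) eq ⟩
  (b % m + c % m) % m  ≡⟨ %-distribˡ-+ b c m ⟨
  (b + c) % m          ∎
  where open ≡-Reasoning

%-congˡ-* : ∀ a b c m .{{_ : NonZero m}} → a % m ≡ b % m → (a * c) % m ≡ (b * c) % m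
%-congˡ-* a b c m eq = begin
  (a * c) % m            ≡⟨ %-distribˡ-* a c m ⟩
  (a % m * (c % m)) % m  ≡⟨ cong (λ z → (z * (c % m)) % m) eq ⟩
  (b % m * (c % m)) % m  ≡⟨ %-distribˡ-* b c m ⟨
  (b * c) % m            ∎
  where open ≡-Reasoning

m∣n∸o⇒n%m≡o%m : .{{_ : NonZero m}} → b ≤ a → m ℕ.∣ a ∸ b → a % m ≡ b % m
m∣n∸o⇒n%m≡o%m {m} {b} {a} b≤a m∣ = begin
  a % m              ≡⟨ cong (_% m) (m+[n∸m]≡n b≤a) ⟨
  (b + (a ∸ b)) % m  ≡⟨ %-remove-+ʳ b m∣ ⟩
  b % m              ∎
  where open ≡-Reasoning

n%m≡o%m⇒m∣n∸o : .{{_ : NonZero m}} → a % m ≡ b % m → m ℕ.∣ a ∸ b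
n%m≡o%m⇒m∣n∸o {m} {a} {b} eq = ℕ.divides (a / m ∸ b / m) (begin
  a ∸ b                                      ≡⟨ cong₂ _∸_ (m≡m%n+[m/n]*n a m) (m≡m%n+[m/n]*n b m) ⟩
  (a % m + a / m * m) ∸ (b % m + b / m * m)  ≡⟨ cong (λ z → (z + a / m * m) ∸ (b % m + b / m * m)) eq ⟩
  (b % m + a / m * m) ∸ (b % m + b / m * m)  ≡⟨ [m+n]∸[m+o]≡n∸o (b % m) _ _ ⟩
  a / m * m ∸ b / m * m                      ≡⟨ *-distribʳ-∸ m (a / m) (b / m) ⟨
  (a / m ∸ b / m) * m                        ∎)
  where open ≡-Reasoning

∣+m-+n∣≡n∸m : a ≤ b → ∣ ℤ.+ a ℤ.- ℤ.+ b ∣ ≡ b ∸ a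
∣+m-+n∣≡n∸m {a} {b} a≤b = trans (cong ∣_∣ (m-n≡m⊖n a b)) (∣⊖∣-≤ a≤b)

∣+m-+n∣≡m∸n : b ≤ a → ∣ ℤ.+ a ℤ.- ℤ.+ b ∣ ≡ a ∸ b
∣+m-+n∣≡m∸n {b} {a} b≤a = trans (cong ∣_∣ (m-n≡m⊖n a b)) (trans (∣m⊖n∣≡∣n⊖m∣ a b) (∣⊖∣-≤ b≤a))

-- The statement phrases congruence as divisibility of an integer difference, while the computations
-- below use remainders of naturals. Deciding which number is larger turns the absolute value into a
-- truncated difference.
mod⇒% : .{{_ : NonZero m}} → a ≡ b [mod m ] → a % m ≡ b % m
mod⇒% {a = a} {b} m∣ with ≤-total a b
... | inj₁ a≤b = sym (m∣n∸o⇒n%m≡o%m a≤b (subst (_ ℕ.∣_) (∣+m-+n∣≡n∸m a≤b) m∣))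
... | inj₂ b≤a = m∣n∸o⇒n%m≡o%m b≤a (subst (_ ℕ.∣_) (∣+m-+n∣≡m∸n b≤a) m∣)

%⇒mod : .{{_ : NonZero m}} → a % m ≡ b % m → a ≡ b [mod m ]
%⇒mod {a = a} {b} eq with ≤-total a b
... | inj₁ a≤b = subst (_ ℕ.∣_) (sym (∣+m-+n∣≡n∸m a≤b)) (n%m≡o%m⇒m∣n∸o (sym eq))
... | inj₂ b≤a = subst (_ ℕ.∣_) (sym (∣+m-+n∣≡m∸n b≤a)) (n%m≡o%m⇒m∣n∸o eq)

%-∣ : ∀ a b m n .{{_ : NonZero m}} .{{_ : NonZero n}} → n ℕ.∣ m → a % m ≡ b % m → a % n ≡ b % n
%-∣ a b m n n∣m eq =
  trans (sym (m∣n⇒o%n%m≡o%m n m a n∣m)) (trans (cong (_% n) eq) (m∣n⇒o%n%m≡o%m n m b n∣m))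

coprime-* : Coprime a b → Coprime a c → Coprime a (b * c)
coprime-* a⊥b a⊥c (d∣a , d∣bc) =
  a⊥c (d∣a , coprime-divisor (λ (f∣d , f∣b) → a⊥b (ℕ.∣-trans f∣d d∣a , f∣b)) d∣bc)

coprime-∏ : (f : Fin d → ℕ) → (∀ k → Coprime a (f k)) → Coprime a (∏ f)
coprime-∏ {d = zero}  f a⊥f = Coprime.sym (Coprime.1-coprimeTo _)
coprime-∏ {d = suc d} f a⊥f = coprime-* {b = f zero} (a⊥f zero) (coprime-∏ (f ∘ suc) (a⊥f ∘ suc))

∣∏ : (f : Fin d → ℕ) → ∀ k → f k ℕ.∣ ∏ f
∣∏ f zero    = ℕ.m∣m*n _
∣∏ f (suc k) = ℕ.∣-trans (∣∏ (f ∘ suc) k) (ℕ.n∣m*n (f zero))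

-- Write `n` as `c * f zero`. By induction the product of the other factors divides `n`; it is
-- coprime to `f zero`, so it divides `c`.
∏∣ : (f : Fin d → ℕ) → (∀ {j k} → j ≢ k → Coprime (f j) (f k)) → (∀ k → f k ℕ.∣ n) → ∏ f ℕ.∣ n
∏∣ {zero}  f ⊥f f∣n = ℕ.1∣ _
∏∣ {suc d} f ⊥f f∣n with f∣n zero
... | ℕ.divides c refl = subst (∏ f ℕ.∣_) (*-comm (f zero) c) (ℕ.*-monoʳ-∣ (f zero)
  (coprime-divisor (Coprime.sym (coprime-∏ (f ∘ suc) (λ k → ⊥f λ ())))
    (∏∣ (f ∘ suc) (λ j≢k → ⊥f λ { refl → j≢k refl })
      (λ k → subst (f (suc k) ℕ.∣_) (*-comm c (f zero)) (f∣n (suc k))))))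

∏≢0 : (f : Fin d → ℕ) → (∀ k → NonZero (f k)) → NonZero (∏ f)
∏≢0 {zero}  f f≢0 = _
∏≢0 {suc d} f f≢0 = m*n≢0 (f zero) _ {{f≢0 zero}} {{∏≢0 (f ∘ suc) (f≢0 ∘ suc)}}

∣∑ : (f : Fin d → ℕ) → (∀ k → m ℕ.∣ f k) → m ℕ.∣ ∑ f
∣∑ {d = zero}  f m∣f = _ ℕ.∣0
∣∑ {d = suc d} f m∣f = ℕ.∣m∣n⇒∣m+n (m∣f zero) (∣∑ (f ∘ suc) (m∣f ∘ suc))

∑-single-% : .{{_ : NonZero m}} (f : Fin d → ℕ) (j : Fin d) → (∀ {k} → k ≢ j → m ℕ.∣ f k) →
  ∑ f % m ≡ f j % m
∑-single-% f zero    m∣f = %-remove-+ʳ (f zero) (∣∑ (f ∘ suc) (λ k → m∣f λ ()))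
∑-single-% f (suc j) m∣f = trans (%-remove-+ˡ _ (m∣f λ ()))
  (∑-single-% (f ∘ suc) j (λ k≢j → m∣f λ { refl → k≢j refl }))

abstract

  -- The inverse is read off from Bézout coefficients. It is abstract because only its defining
  -- congruence matters later.
  inverse-% : .{{_ : NonZero n}} → Coprime m n → ∃ λ u → (m * u) % n ≡ 1 % n
  inverse-% {n} {m} m⊥n with coprime-Bézout m⊥n
  ... | Bézout.+- x y eq = x , (begin
    (m * x) % n      ≡⟨ cong (_% n) (trans (*-comm m x) (sym eq)) ⟩
    (1 + y * n) % n  ≡⟨ [m+kn]%n≡m%n 1 y n ⟩
    1 % n            ∎)
    where open ≡-Reasoning
  -- Here x m ≡ −1, so the inverse is −x ≡ x² m.
  ... | Bézout.-+ x y eq = x * (m * x) , (begin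
    (m * (x * (m * x))) % n          ≡⟨ [m+kn]%n≡m%n (m * (x * (m * x))) y n ⟨
    (m * (x * (m * x)) + y * n) % n  ≡⟨ cong (_% n) (lemma (sym eq)) ⟩
    (1 + (x * m) * y * n) % n        ≡⟨ [m+kn]%n≡m%n 1 (x * m * y) n ⟩
    1 % n                            ∎)
    where
    open ≡-Reasoning
    lemma : y * n ≡ 1 + x * m → m * (x * (m * x)) + y * n ≡ 1 + x * m * y * n
    lemma e = begin
      m * (x * (m * x)) + y * n        ≡⟨ cong (m * (x * (m * x)) +_) e ⟩
      m * (x * (m * x)) + (1 + x * m)  ≡⟨ solve m x ⟩
      1 + x * m * (1 + x * m)          ≡⟨ cong (λ z → 1 + x * m * z) e ⟨
      1 + x * m * (y * n)              ≡⟨ cong suc (*-assoc (x * m) y n) ⟨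
      1 + x * m * y * n                ∎
      where
      solve : ∀ m x → m * (x * (m * x)) + (1 + x * m) ≡ 1 + x * m * (1 + x * m)
      solve = solve-∀

-- Coordinates on ℤ_M

prime-coprime : ∀ {p q} → Prime p → Prime q → p ≢ q → Coprime p q
prime-coprime pp pq p≢q (e∣p , e∣q) with prime⇒irreducible pp e∣p | prime⇒irreducible pq e∣q
... | inj₁ e≡1 | _        = e≡1
... | inj₂ _   | inj₁ e≡1 = e≡1
... | inj₂ e≡p | inj₂ e≡q = contradiction (trans (sym e≡p) e≡q) p≢q

coprime-² : ∀ {a b} → Coprime a b → Coprime (a ^ 2) (b ^ 2)
coprime-² {a} {b} a⊥b = square b (square a a⊥b)
  where
  square : ∀ n {c} → Coprime n c → Coprime c (n ^ 2)
  square n n⊥c = subst (Coprime _) (cong (n *_) (sym (*-identityʳ n)))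
    (coprime-* {b = n} (Coprime.sym n⊥c) (Coprime.sym n⊥c))

-- The factors of Mj are a function local to its definition, which only unification can name.
factorsOf : ∀ {d n} (f : Fin d → ℕ) → ∏ f ≡ n → Fin d → ℕ
factorsOf f _ = f

module Coordinates {d : ℕ} (p : Fin d → ℕ) (prime : ∀ j → Prime (p j))
                   (p-injective : Injective _≡_ _≡_ p) where

  open Cube p

  q : Fin d → ℕ
  q j = p j ^ 2

  instance
    p≢0 : ∀ {j} → NonZero (p j)
    p≢0 {j} = prime⇒nonZero (prime j)

    q≢0 : ∀ {j} → NonZero (q j)
    q≢0 {j} = m^n≢0 (p j) 2

    M≢0 : NonZero M
    M≢0 = ∏≢0 q (λ j → q≢0 {j})

  q-coprime : ∀ {j k} → j ≢ k → Coprime (q j) (q k)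
  q-coprime j≢k = coprime-² (prime-coprime (prime _) (prime _) (j≢k ∘ p-injective))

  factor : Fin d → Fin d → ℕ
  factor j = factorsOf _ (refl {x = Mj j})

  factor-≢ : ∀ {j k} → k ≢ j → factor j k ≡ q k
  factor-≢ {j} {k} k≢j with k ≟ j
  ... | yes k≡j = contradiction k≡j k≢j
  ... | no  _   = refl

  q-coprime-factor : ∀ j k → Coprime (q j) (factor j k)
  q-coprime-factor j k with k ≟ j
  ... | yes _   = Coprime.sym (Coprime.1-coprimeTo _)
  ... | no  k≢j = q-coprime (k≢j ∘ sym)

  q∣Mj : ∀ {j k} → j ≢ k → q j ℕ.∣ Mj k
  q∣Mj {j} {k} j≢k = subst (ℕ._∣ Mj k) (factor-≢ j≢k) (∣∏ (factor k) j)

  Mj-inverse : ∀ j → ∃ λ u → (Mj j * u) % q j ≡ 1 % q j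
  Mj-inverse j = inverse-% (Coprime.sym (coprime-∏ (factor j) (q-coprime-factor j)))

  -- Multiplying by the inverse of `Mj j` turns `Mj j` into the unit of the circle of length `q j`,
  -- where every other `Mj k` vanishes. Hence `B` becomes a box of independent offsets.
  χ : ℕ → Fin d → ℕ
  χ a j = (a * proj₁ (Mj-inverse j)) % q j

  χ-< : ∀ a j → χ a j < q j
  χ-< a j = m%n<n _ (q j)

  χ-% : ∀ a j → χ a j % q j ≡ χ a j
  χ-% a j = m%n%n≡m%n _ (q j)

  χ-cong : ∀ a b → a % M ≡ b % M → ∀ j → χ a j ≡ χ b j
  χ-cong a b eq j = %-congˡ-* a b _ (q j) (%-∣ a b M (q j) (∣∏ q j) eq)

  χ-+ : ∀ a b j → χ (a + b) j ≡ (χ a j + χ b j) % q j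
  χ-+ a b j = trans (cong (_% q j) (*-distribʳ-+ (proj₁ (Mj-inverse j)) a b))
    (%-distribˡ-+ (a * proj₁ (Mj-inverse j)) _ (q j))

  -- Chinese remainder theorem: multiplying by `Mj j` undoes the division, so `a` and `b` agree
  -- modulo every `q j`, and these are pairwise coprime with product `M`.
  χ-injective : ∀ a b → (∀ j → χ a j ≡ χ b j) → a % M ≡ b % M
  χ-injective a b eq = mod⇒% (∏∣ q q-coprime λ j → %⇒mod {m = q j} {a} {b} (begin
    a % q j                                  ≡⟨ undo a j ⟨
    (a * proj₁ (Mj-inverse j) * Mj j) % q j  ≡⟨ %-congˡ-* (a * proj₁ (Mj-inverse j)) (b * proj₁ (Mj-inverse j)) (Mj j) (q j) (eq j) ⟩
    (b * proj₁ (Mj-inverse j) * Mj j) % q j  ≡⟨ undo b j ⟩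
    b % q j                                  ∎))
    where
    open ≡-Reasoning
    undo : ∀ a j → (a * proj₁ (Mj-inverse j) * Mj j) % q j ≡ a % q j
    undo a j = begin
      (a * u * Mj j) % q j  ≡⟨ cong (_% q j) (trans (*-assoc a u (Mj j)) (*-comm a _)) ⟩
      (u * Mj j * a) % q j  ≡⟨ cong (λ z → (z * a) % q j) (*-comm u (Mj j)) ⟩
      (Mj j * u * a) % q j  ≡⟨ %-congˡ-* (Mj j * u) 1 a (q j) (proj₂ (Mj-inverse j)) ⟩
      (1 * a) % q j         ≡⟨ cong (_% q j) (*-identityˡ a) ⟩
      a % q j               ∎
      where u = proj₁ (Mj-inverse j)

  χ-*Mj : ∀ c j → χ (c * Mj j) j ≡ c % q j
  χ-*Mj c j = begin
    (c * Mj j * u) % q j  ≡⟨ cong (_% q j) (trans (*-assoc c (Mj j) u) (*-comm c _)) ⟩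
    (Mj j * u * c) % q j  ≡⟨ %-congˡ-* (Mj j * u) 1 c (q j) (proj₂ (Mj-inverse j)) ⟩
    (1 * c) % q j         ≡⟨ cong (_% q j) (*-identityˡ c) ⟩
    c % q j               ∎
    where
    open ≡-Reasoning
    u = proj₁ (Mj-inverse j)

  χ-*Mj-≢ : ∀ c {j k} → j ≢ k → χ (c * Mj k) j ≡ 0
  χ-*Mj-≢ c {j} j≢k = ℕ.n∣m⇒m%n≡0 _ (q j) (ℕ.∣m⇒∣m*n _ (ℕ.∣n⇒∣m*n c (q∣Mj j≢k)))

  -- This serves twice: it realizes prescribed coordinates by an element of ℤ_M, and it reads off
  -- the coordinates of an element of `B`.
  χ-∑ : (c : Fin d → ℕ) → ∀ j → χ (∑ (λ k → c k * Mj k)) j ≡ c j % q j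
  χ-∑ c j = trans
    (%-congˡ-* (∑ f) (f j) _ (q j) (∑-single-% f j (λ {k} k≢j → ℕ.∣n⇒∣m*n (c k) (q∣Mj (k≢j ∘ sym)))))
    (χ-*Mj (c j) j)
    where f = λ k → c k * Mj k

-- Tilings by words

-- A word stands for a box: per coordinate, its shift and its level.  A point is known only through,
-- per coordinate, the level of the unshifted and of the shifted interval that contain it.
Word Point : ℕ → Set
Word  = Vec (Bool × Bool)
Point = Vec (Bool × Bool)

_∋_ : Bool × Bool → Bool × Bool → Set
(s , l) ∋ (b₀ , b₁) = l ≡ (if s then b₁ else b₀)

Contains : ∀ {n} → Word n → Point n → Set
Contains = Pointwise _∋_

flip : ∀ {n} → Fin n → Word n → Word n
flip i w = updateAt w i (map₂ not)

-- Points range over all four pairs of bits in each coordinate, so the condition is finite and does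
-- not involve the primes.
record TwinFreeTiling (n : ℕ) : Set where
  field
    tile      : Word n → Bool
    cover     : ∀ b → ∃ λ w → tile w ≡ true × Contains w b
    unique    : ∀ {b w w′} → tile w ≡ true → tile w′ ≡ true →
                Contains w b → Contains w′ b → w ≡ w′
    twin-free : ∀ {w} i → tile w ≡ true → ¬ tile (flip i w) ≡ true

-- Adding a dimension

module Layers {m : ℕ} (T : TwinFreeTiling (suc m)) where
  open TwinFreeTiling T

  twist : Bool → Word (suc m) → Word (suc m)
  twist l w = if l then flip zero w else w

  -- Both bits are negated: a word reads one or the other according to its shift, and its level is
  -- exchanged either way.
  twistᵖ : Bool → Point (suc m) → Point (suc m)
  twistᵖ false b               = b
  twistᵖ true  ((b₀ , b₁) ∷ b) = (not b₀ , not b₁) ∷ b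

  twist-involutive : ∀ l w → twist l (twist l w) ≡ w
  twist-involutive false w             = refl
  twist-involutive true  ((s , l) ∷ w) = cong (λ z → (s , z) ∷ w) (Bool.not-involutive l)

  twistᵖ-involutive : ∀ l b → twistᵖ l (twistᵖ l b) ≡ b
  twistᵖ-involutive false b               = refl
  twistᵖ-involutive true  ((b₀ , b₁) ∷ b) =
    cong₂ (λ y z → (y , z) ∷ b) (Bool.not-involutive b₀) (Bool.not-involutive b₁)

  twist-flip : ∀ l i w → twist l (flip i w) ≡ flip i (twist l w)
  twist-flip false i       w       = refl
  twist-flip true  zero    (_ ∷ _) = refl
  twist-flip true  (suc i) (_ ∷ _) = refl

  twist-contains : ∀ l {w b} → Contains w b → Contains (twist l w) (twistᵖ l b)
  twist-contains false w∋b                              = w∋b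
  twist-contains true  {(false , _) ∷ _} {_ ∷ _} (refl ∷ w∋b) = refl ∷ w∋b
  twist-contains true  {(true  , _) ∷ _} {_ ∷ _} (refl ∷ w∋b) = refl ∷ w∋b

  -- The new coordinate is never shifted, so its level alone selects the layer: low carries the
  -- given tiling, high carries its image under the exchange of levels in coordinate zero.
  layered : Word (suc (suc m)) → Bool
  layered ((s , l) ∷ w) = not s ∧ tile (twist l w)

  layers : TwinFreeTiling (suc (suc m))
  layers = record { tile = layered ; cover = cover′ ; unique = unique′ ; twin-free = λ {w} → twin-free′ {w} }
    where
    cover′ : ∀ b → ∃ λ w → layered w ≡ true × Contains w b
    cover′ ((b₀ , b₁) ∷ b) with cover (twistᵖ b₀ b)
    ... | w , w∈ , w∋b = (false , b₀) ∷ twist b₀ w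
                       , subst (λ z → tile z ≡ true) (sym (twist-involutive b₀ w)) w∈
                       , refl ∷ subst (Contains _) (twistᵖ-involutive b₀ b) (twist-contains b₀ w∋b)

    unique′ : ∀ {b w w′} → layered w ≡ true → layered w′ ≡ true →
              Contains w b → Contains w′ b → w ≡ w′
    unique′ {w = (false , l) ∷ w} {(false , _) ∷ w′} w∈ w′∈ (refl ∷ w∋b) (refl ∷ w′∋b) =
      cong ((false , l) ∷_) (begin
        w                     ≡⟨ twist-involutive l w ⟨
        twist l (twist l w)   ≡⟨ cong (twist l) (unique w∈ w′∈ (twist-contains l w∋b) (twist-contains l w′∋b)) ⟩
        twist l (twist l w′)  ≡⟨ twist-involutive l w′ ⟩
        w′                    ∎)
      where open ≡-Reasoning

    -- Twins in the new direction would be one word lying in both layers, which makes that word and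
    -- its flip in coordinate zero two tiles of the old tiling. Twins in an old direction lie in one
    -- layer, and twisting keeps them twins.
    twin-free′ : ∀ {w} i → layered w ≡ true → ¬ layered (flip i w) ≡ true
    twin-free′ {(false , false) ∷ w} zero    w∈ w′∈ = twin-free zero w∈ w′∈
    twin-free′ {(false , true)  ∷ w} zero    w∈ w′∈ =
      twin-free zero w∈ (subst (λ z → tile z ≡ true) (sym (twist-involutive true w)) w′∈)
    twin-free′ {(false , l)     ∷ w} (suc i) w∈ w′∈ =
      twin-free i w∈ (subst (λ z → tile z ≡ true) (twist-flip l i w) w′∈)

layers^ : ∀ {m} k → TwinFreeTiling (suc m) → TwinFreeTiling (suc (k + m))
layers^ zero    T = T
layers^ (suc k) T = Layers.layers (layers^ k T)

-- Checking a list of words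

_∋?_ : ∀ x q → Dec (x ∋ q)
(s , l) ∋? (b₀ , b₁) = l Bool.≟ (if s then b₁ else b₀)

contains? : ∀ {n} (w : Word n) b → Dec (Contains w b)
contains? = decidable _∋?_

∀ᵇ : (Bool × Bool → Bool) → Bool
∀ᵇ f = f (false , false) ∧ f (false , true) ∧ f (true , false) ∧ f (true , true)

∀ᵇ-sound : ∀ f → ∀ᵇ f ≡ true → ∀ x → f x ≡ true
∀ᵇ-sound f e x
  with f (false , false) in e₀ | f (false , true) in e₁ | f (true , false) in e₂ | f (true , true) in e₃ | e | x
... | true | true | true | true | refl | false , false = e₀
... | true | true | true | true | refl | false , true  = e₁
... | true | true | true | true | refl | true  , false = e₂
... | true | true | true | true | refl | true  , true  = e₃

tails : ∀ {n} {P : Bool × Bool → Set} → Decidable P → List (Word (suc n)) → List (Word n)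
tails P? []             = []
tails P? ((x ∷ w) ∷ ws) = if does (P? x) then w ∷ tails P? ws else tails P? ws

∈-tails : ∀ {n} {P : Bool × Bool → Set} (P? : Decidable P) {x} {w : Word n} {ws} →
  P x → x ∷ w ∈ ws → w ∈ tails P? ws
∈-tails P? {x} px (here refl) with P? x
... | yes _  = here refl
... | no ¬px = contradiction px ¬px
∈-tails P? {ws = (y ∷ _) ∷ _} px (there w∈) with P? y
... | yes _ = there (∈-tails P? px w∈)
... | no  _ = ∈-tails P? px w∈

-- Fixing the point one coordinate at a time halves the list on average, which makes the test of
-- all 4 ^ n points affordable.
restrict : ∀ {n} → Bool × Bool → List (Word (suc n)) → List (Word n)
restrict q = tails (_∋? q)

exact : ∀ {n} → List (Word n) → Bool
exact {zero}  ws = length ws ≡ᵇ 1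
exact {suc n} ws = ∀ᵇ λ q → exact (restrict q ws)

_≟ᵈ_ : DecidableEquality (Bool × Bool)
_≟ᵈ_ = Product.≡-dec Bool._≟_ Bool._≟_

section : ∀ {n} → Bool × Bool → List (Word (suc n)) → List (Word n)
section x = tails (x ≟ᵈ_)

-- Splitting both lists by first entries, as in a trie, avoids comparing all pairs. At length zero
-- there is only one word, so disjointness means that one list is empty.
disjoint : ∀ {n} → List (Word n) → List (Word n) → Bool
disjoint {zero}  ws vs = null ws ∨ null vs
disjoint {suc n} ws vs = ∀ᵇ λ x → disjoint (section x ws) (section x vs)

disjoint-sound : ∀ {n} (ws vs : List (Word n)) → disjoint ws vs ≡ true → ∀ {w} → w ∈ ws → ¬ w ∈ vs
disjoint-sound {zero}  (_ ∷ _) []      e w∈ws ()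
disjoint-sound {suc n} ws      vs      e {x ∷ w} w∈ws w∈vs =
  disjoint-sound (section x ws) (section x vs)
    (∀ᵇ-sound (λ x → disjoint (section x ws) (section x vs)) e x)
    (∈-tails (x ≟ᵈ_) refl w∈ws) (∈-tails (x ≟ᵈ_) refl w∈vs)

-- Twins either share their first entry, and their tails are twins in one section, or differ in its
-- level, and one common tail lies in two opposite sections.
twinFree : ∀ {n} → List (Word n) → Bool
twinFree {zero}  ws = true
twinFree {suc n} ws = ∀ᵇ λ x → twinFree (section x ws) ∧ disjoint (section x ws) (section (map₂ not x) ws)

twinFree-sound : ∀ {n} (ws : List (Word n)) → twinFree ws ≡ true → ∀ {w} i → w ∈ ws → ¬ flip i w ∈ ws
twinFree-sound {suc n} ws e {x ∷ w} i w∈ w′∈ = cases i w′∈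
  where
  ws-x : twinFree (section x ws) ∧ disjoint (section x ws) (section (map₂ not x) ws) ≡ true
  ws-x = ∀ᵇ-sound (λ x → twinFree (section x ws) ∧ disjoint (section x ws) (section (map₂ not x) ws)) e x

  cases : ∀ i → ¬ flip i (x ∷ w) ∈ ws
  cases zero    w′∈ = disjoint-sound (section x ws) (section (map₂ not x) ws)
    (Bool.∧-conicalʳ (twinFree (section x ws)) _ ws-x) (∈-tails (x ≟ᵈ_) refl w∈) (∈-tails (map₂ not x ≟ᵈ_) refl w′∈)
  cases (suc i) w′∈ = twinFree-sound (section x ws)
    (Bool.∧-conicalˡ _ (disjoint (section x ws) (section (map₂ not x) ws)) ws-x)
    i (∈-tails (x ≟ᵈ_) refl w∈) (∈-tails (x ≟ᵈ_) refl w′∈)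

containing : ∀ {n} → Point n → List (Word n) → List (Word n)
containing b = filter (λ w → contains? w b)

-- This justifies fixing one coordinate at a time. Taking tails preserves length, so a single
-- survivor after restriction comes from a single word containing the whole point.
map-tail-containing : ∀ {n} q (b : Point n) ws →
  map Vec.tail (containing (q ∷ b) ws) ≡ containing b (restrict q ws)
map-tail-containing q b []             = refl
map-tail-containing q b ((x ∷ w) ∷ ws) with x ∋? q
... | no  _ = map-tail-containing q b ws
... | yes _ with contains? w b
...   | yes _ = cong (w ∷_) (map-tail-containing q b ws)
...   | no  _ = map-tail-containing q b ws

exact⇒singleton : ∀ {n} (ws : List (Word n)) → exact ws ≡ true → ∀ b → ∃ λ w → containing b ws ≡ w ∷ []
exact⇒singleton {zero}  ([] ∷ []) _ []      = [] , refl
exact⇒singleton {suc n} ws        e (q ∷ b)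
  with containing (q ∷ b) ws | map-tail-containing q b ws
     | exact⇒singleton (restrict q ws) (∀ᵇ-sound (λ q → exact (restrict q ws)) e q) b
... | []        | eq | w , eq′ = contradiction (trans eq eq′) λ ()
... | v ∷ []    | eq | w , eq′ = v , refl
... | _ ∷ _ ∷ _ | eq | w , eq′ = contradiction (trans eq eq′) λ ()

_∈?_ : ∀ {n} (w : Word n) ws → Dec (w ∈ ws)
_∈?_ = Membership._∈?_ (≡-dec _≟ᵈ_)

fromList : ∀ {n} (ws : List (Word n)) → exact ws ≡ true → twinFree ws ≡ true → TwinFreeTiling n
fromList {n} ws e tf = record
  { tile      = λ w → ⌊ w ∈? ws ⌋
  ; cover     = cover
  ; unique    = λ {b} {w} {w′} w∈ w′∈ w∋b w′∋b → unique b (⌊⌋⇒∈ w w∈) (⌊⌋⇒∈ w′ w′∈) w∋b w′∋b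
  ; twin-free = λ {w} i w∈ w′∈ → twinFree-sound ws tf i (⌊⌋⇒∈ w w∈) (⌊⌋⇒∈ (flip i w) w′∈)
  }
  where
  ⌊⌋⇒∈ : ∀ w → ⌊ w ∈? ws ⌋ ≡ true → w ∈ ws
  ⌊⌋⇒∈ w eq with w ∈? ws
  ... | yes w∈ = w∈

  ∈⇒⌊⌋ : ∀ w → w ∈ ws → ⌊ w ∈? ws ⌋ ≡ true
  ∈⇒⌊⌋ w w∈ with w ∈? ws
  ... | yes _ = refl
  ... | no w∉ = contradiction w∈ w∉

  cover : ∀ b → ∃ λ w → ⌊ w ∈? ws ⌋ ≡ true × Contains w b
  cover b with exact⇒singleton ws e b
  ... | w , eq with ∈-filter⁻ (λ w → contains? w b) {xs = ws} (subst (w ∈_) (sym eq) (here refl))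
  ... | w∈ , w∋b = w , ∈⇒⌊⌋ w w∈ , w∋b

  unique : ∀ b {w w′} → w ∈ ws → w′ ∈ ws → Contains w b → Contains w′ b → w ≡ w′
  unique b {w} {w′} w∈ w′∈ w∋b w′∋b with exact⇒singleton ws e b
  ... | v , eq = trans (only w w∈ w∋b) (sym (only w′ w′∈ w′∋b))
    where
    only : ∀ w → w ∈ ws → Contains w b → w ≡ v
    only w w∈ w∋b with subst (w ∈_) eq (∈-filter⁺ (λ w → contains? w b) w∈ w∋b)
    ... | here w≡v = w≡v

-- Dimension 8

-- The digits of the Keller graph: d and d + 2 are the two levels of the same shift.
digit : ℕ → Bool × Bool
digit 0 = false , false
digit 1 = true  , false
digit 2 = false , true
digit _ = true  , true

word : ℕ → ℕ → ℕ → ℕ → Word 4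
word w x y z = digit w ∷ digit x ∷ digit y ∷ digit z ∷ []

_⊗_ : List (Word 4) → List (Word 4) → List (Word 8)
_⊗_ = cartesianProductWith Vec._++_

-- Found by a computer search among sets invariant under a group of order 64.  The group acts, on
-- each half of the coordinates, by symmetries of a splitting of the 4-dimensional torus into four
-- rigid cubes and a region that two disjoint twin-free sets of twelve cubes tile.
A₁ B₁ A₂ B₂ A₃ B₃ A₄ B₄ A₅ B₅ : List (Word 4)
A₁ = word 0 1 0 3 ∷ word 1 2 2 1 ∷ word 2 0 1 0 ∷ word 3 3 3 2 ∷ []
B₁ = word 0 0 0 0 ∷ word 0 1 2 1 ∷ word 0 3 2 0 ∷ word 1 0 0 2 ∷
     word 1 2 0 3 ∷ word 1 3 2 2 ∷ word 2 0 1 0 ∷ word 2 1 2 2 ∷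
     word 2 2 2 0 ∷ word 3 1 0 2 ∷ word 3 2 0 0 ∷ word 3 3 3 2 ∷ []
A₂ = word 0 1 0 1 ∷ word 1 2 2 3 ∷ word 2 0 3 0 ∷ word 3 3 1 2 ∷ []
B₂ = word 0 0 2 2 ∷ word 0 1 0 1 ∷ word 0 3 0 2 ∷ word 1 0 2 0 ∷
     word 1 2 2 3 ∷ word 1 3 0 0 ∷ word 2 0 1 2 ∷ word 2 1 0 0 ∷
     word 2 2 0 2 ∷ word 3 1 2 0 ∷ word 3 2 2 2 ∷ word 3 3 3 0 ∷ []
A₃ = word 0 0 1 1 ∷ word 0 1 2 3 ∷ word 0 3 1 3 ∷ word 1 0 3 1 ∷
     word 1 2 0 1 ∷ word 1 3 3 3 ∷ word 2 0 1 2 ∷ word 2 1 3 3 ∷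
     word 2 2 1 3 ∷ word 3 1 3 1 ∷ word 3 2 1 1 ∷ word 3 3 3 0 ∷ []
B₃ = word 0 1 0 3 ∷ word 1 2 2 1 ∷ word 2 0 3 2 ∷ word 3 3 1 0 ∷ []
A₄ = word 0 0 3 3 ∷ word 0 1 2 1 ∷ word 0 3 3 1 ∷ word 1 0 1 3 ∷
     word 1 2 0 3 ∷ word 1 3 1 1 ∷ word 2 0 3 2 ∷ word 2 1 1 1 ∷
     word 2 2 3 1 ∷ word 3 1 1 3 ∷ word 3 2 3 3 ∷ word 3 3 1 0 ∷ []
B₄ = word 0 1 2 3 ∷ word 1 2 0 1 ∷ word 2 0 3 0 ∷ word 3 3 1 2 ∷ []
A₅ = word 0 0 2 0 ∷ word 0 3 0 0 ∷ word 1 0 2 2 ∷ word 1 3 0 2 ∷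
     word 2 1 0 2 ∷ word 2 2 0 0 ∷ word 3 1 2 2 ∷ word 3 2 2 0 ∷ []
B₅ = word 0 0 3 1 ∷ word 0 3 3 3 ∷ word 1 0 1 1 ∷ word 1 3 1 3 ∷
     word 2 1 1 3 ∷ word 2 2 3 3 ∷ word 3 1 1 1 ∷ word 3 2 3 1 ∷ []

keller₈ : List (Word 8)
keller₈ = (A₁ ⊗ B₁) ++ (A₂ ⊗ B₂) ++ (A₃ ⊗ B₃) ++ (A₄ ⊗ B₄) ++ (A₅ ⊗ B₅)

abstract
  -- Proved by evaluating the test at all 4 ^ 8 = 65536 points; abstract, so that later definitions
  -- do not unfold it.
  keller₈-exact : exact keller₈ ≡ true
  keller₈-exact = refl

  keller₈-twinFree : twinFree keller₈ ≡ true
  keller₈-twinFree = refl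

tiling₈ : TwinFreeTiling 8
tiling₈ = fromList keller₈ keller₈-exact keller₈-twinFree

-- From words to ℤ_M

-- It reads an interval's index as a level, index 0 being low and all others high, and a residue 0
-- or 1 as a shift.
positive : ℕ → Bool
positive zero    = false
positive (suc _) = true

bit : Bool → ℕ
bit false = 0
bit true  = 1

positive-bit : ∀ s → positive (bit s) ≡ s
positive-bit false = refl
positive-bit true  = refl

bit-positive : ∀ {r} → r ≤ 1 → bit (positive r) ≡ r
bit-positive {zero}        _ = refl
bit-positive {suc zero}    _ = refl
bit-positive {suc (suc _)} (s≤s ())

-- Intervals on one circle

module Circle (n : ℕ) .{{_ : NonZero n}} (1<n : 1 < n) where

  private instance
    n²≢0 : NonZero (n ^ 2)
    n²≢0 = m^n≢0 n 2

  n²≡n*n : n ^ 2 ≡ n * n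
  n²≡n*n = cong (n *_) (*-identityʳ n)

  bit<n : ∀ s → bit s < n
  bit<n false = <-trans (s≤s z≤n) 1<n
  bit<n true  = 1<n

  bit≤n² : ∀ s → bit s ≤ n ^ 2
  bit≤n² s = ≤-trans (<⇒≤ (bit<n s)) (subst (n ≤_) (sym n²≡n*n) (m≤m*n n n))

  wordDigit : ℕ → Bool × Bool
  wordDigit x = positive (x % n) , positive (x / n)

  -- y − bit s modulo n².
  back : Bool → ℕ → ℕ
  back s y = (y + (n ^ 2 ∸ bit s)) % (n ^ 2)

  pointDigit : ℕ → Bool × Bool
  pointDigit y = positive (back false y / n) , positive (back true y / n)

  -- The start of the interval of shift `s` around `y`. The last shifted interval wraps past 0, but
  -- its start does not.
  start : Bool → ℕ → ℕ
  start s y = bit s + back s y / n * n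

  pointDigit-if : ∀ s y → positive (back s y / n) ≡ (if s then proj₂ (pointDigit y) else proj₁ (pointDigit y))
  pointDigit-if false y = refl
  pointDigit-if true  y = refl

  r+kn<n² : ∀ {r k} → r < n → k < n → r + k * n < n ^ 2
  r+kn<n² {r} {k} r<n k<n = begin-strict
    r + k * n  <⟨ +-monoˡ-< (k * n) r<n ⟩
    suc k * n  ≤⟨ *-monoˡ-≤ n k<n ⟩
    n * n      ≡⟨ n²≡n*n ⟨
    n ^ 2      ∎
    where open ≤-Reasoning

  [r+kn]/n≡k : ∀ {r} k → r < n → (r + k * n) / n ≡ k
  [r+kn]/n≡k {r} k r<n = begin
    (r + k * n) / n    ≡⟨ +-distrib-/-∣ʳ r (ℕ.n∣m*n k) ⟩
    r / n + k * n / n  ≡⟨ cong₂ _+_ (m<n⇒m/n≡0 r<n) (m*n/n≡m k n) ⟩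
    k                  ∎
    where open ≡-Reasoning

  [r+kn]%n≡r : ∀ {r} k → r < n → (r + k * n) % n ≡ r
  [r+kn]%n≡r {r} k r<n = trans ([m+kn]%n≡m%n r k n) (m<n⇒m%n≡m r<n)

  x<n²⇒x/n<n : ∀ {x} → x < n ^ 2 → x / n < n
  x<n²⇒x/n<n {x} x<n² = m<n*o⇒m/o<n (subst (x <_) n²≡n*n x<n²)

  start<n² : ∀ s y → start s y < n ^ 2
  start<n² s y = r+kn<n² (bit<n s) (x<n²⇒x/n<n (m%n<n _ (n ^ 2)))

  wordDigit-start : ∀ s y → wordDigit (start s y) ≡ (s , positive (back s y / n))
  wordDigit-start s y = cong₂ _,_
    (trans (cong positive ([r+kn]%n≡r (back s y / n) (bit<n s))) (positive-bit s))
    (cong positive ([r+kn]/n≡k (back s y / n) (bit<n s)))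

  start%n≤1 : ∀ s y → start s y % n ≤ 1
  start%n≤1 s y = subst (_≤ 1) (sym ([r+kn]%n≡r (back s y / n) (bit<n s))) (bit≤1 s)
    where
    bit≤1 : ∀ s → bit s ≤ 1
    bit≤1 false = z≤n
    bit≤1 true  = s≤s z≤n

  start-back : ∀ s y → (start s y + back s y % n) % (n ^ 2) ≡ y % (n ^ 2)
  start-back s y = begin
    (bit s + r / n * n + r % n) % (n ^ 2)    ≡⟨ cong (_% (n ^ 2)) (+-assoc (bit s) _ _) ⟩
    (bit s + (r / n * n + r % n)) % (n ^ 2)  ≡⟨ cong (λ z → (bit s + z) % (n ^ 2)) (trans (+-comm _ (r % n)) (sym (m≡m%n+[m/n]*n r n))) ⟩
    (bit s + r) % (n ^ 2)                    ≡⟨ cong (_% (n ^ 2)) (+-comm (bit s) r) ⟩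
    (r + bit s) % (n ^ 2)                    ≡⟨ %-congˡ-+ r (y + (n ^ 2 ∸ bit s)) (bit s) (n ^ 2) (m%n%n≡m%n _ (n ^ 2)) ⟩
    (y + (n ^ 2 ∸ bit s) + bit s) % (n ^ 2)  ≡⟨ cong (_% (n ^ 2)) (trans (+-assoc y _ _) (cong (y +_) (m∸n+n≡m (bit≤n² s)))) ⟩
    (y + n ^ 2) % (n ^ 2)                    ≡⟨ [m+n]%n≡m%n y (n ^ 2) ⟩
    y % (n ^ 2)                              ∎
    where
    open ≡-Reasoning
    r = back s y

  -- Since `x` is `bit s + x / n * n`, removing the shift from `x + c` leaves `c + x / n * n`, which
  -- is already below `n ^ 2`. Its quotient and remainder by `n` therefore recover the interval's
  -- index and the offset.
  back-unique : ∀ {x c y} → x < n ^ 2 → x % n ≤ 1 → c < n → (x + c) % (n ^ 2) ≡ y →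
                back (positive (x % n)) y ≡ c + x / n * n
  back-unique {x} {c} {y} x<n² r≤1 c<n refl = begin
    ((x + c) % (n ^ 2) + (n ^ 2 ∸ bit s)) % (n ^ 2)  ≡⟨ %-congˡ-+ ((x + c) % (n ^ 2)) (x + c) _ (n ^ 2) (m%n%n≡m%n _ (n ^ 2)) ⟩
    (x + c + (n ^ 2 ∸ bit s)) % (n ^ 2)              ≡⟨ cong (_% (n ^ 2)) rearrange ⟩
    (c + x / n * n + n ^ 2) % (n ^ 2)                ≡⟨ [m+n]%n≡m%n (c + x / n * n) (n ^ 2) ⟩
    (c + x / n * n) % (n ^ 2)                        ≡⟨ m<n⇒m%n≡m (r+kn<n² c<n (x<n²⇒x/n<n x<n²)) ⟩
    c + x / n * n                                    ∎
    where
    open ≡-Reasoning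
    s = positive (x % n)
    e = n ^ 2 ∸ bit s
    rearrange : x + c + e ≡ c + x / n * n + n ^ 2
    rearrange = begin
      x + c + e                    ≡⟨ cong (λ z → z + c + e) (m≡m%n+[m/n]*n x n) ⟩
      x % n + x / n * n + c + e    ≡⟨ cong (λ z → z + x / n * n + c + e) (sym (bit-positive r≤1)) ⟩
      bit s + x / n * n + c + e    ≡⟨ swap (bit s) (x / n * n) c e ⟩
      c + x / n * n + (e + bit s)  ≡⟨ cong (c + x / n * n +_) (m∸n+n≡m (bit≤n² s)) ⟩
      c + x / n * n + n ^ 2        ∎
      where
      swap : ∀ a b c d → a + b + c + d ≡ c + b + (d + a)
      swap = solve-∀

  module _ {x c y} (x<n² : x < n ^ 2) (r≤1 : x % n ≤ 1) (c<n : c < n) (x+c≡y : (x + c) % (n ^ 2) ≡ y) where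

    x/n-unique : x / n ≡ back (positive (x % n)) y / n
    x/n-unique = sym (trans (cong (_/ n) (back-unique x<n² r≤1 c<n x+c≡y)) ([r+kn]/n≡k (x / n) c<n))

    start-unique : x ≡ start (positive (x % n)) y
    start-unique = trans (m≡m%n+[m/n]*n x n)
      (cong₂ (λ r k → r + k * n) (sym (bit-positive r≤1)) x/n-unique)

    offset-unique : c ≡ back (positive (x % n)) y % n
    offset-unique = sym (trans (cong (_% n) (back-unique x<n² r≤1 c<n x+c≡y)) ([r+kn]%n≡r (x / n) c<n))

    wordDigit-∋ : wordDigit x ∋ pointDigit y
    wordDigit-∋ = trans (cong positive x/n-unique) (pointDigit-if (positive (x % n)) y)

  -- Steps of `n` run through all intervals of one shift. From index 0 one step reaches the high
  -- index 1; from index `suc a`, `n ∸ suc a` steps go once around to index 0.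
  opposite : ∀ {x} → x < n ^ 2 →
    ∃ λ k → k < n × (x + k * n) % (n ^ 2) % n ≡ x % n
                  × positive ((x + k * n) % (n ^ 2) / n) ≡ not (positive (x / n))
  opposite {x} x<n² with x / n in eq
  ... | zero  = 1 , 1<n
              , trans (cong (λ z → z % n) [x+n]) ([m+kn]%n≡m%n x 1 n)
              , trans (cong (λ z → positive (z / n)) [x+n]) (cong positive
                  (trans (cong (λ z → (z + 1 * n) / n) x≡x%n) ([r+kn]/n≡k 1 (m%n<n x n))))
    where
    x≡x%n : x ≡ x % n
    x≡x%n = trans (m≡m%n+[m/n]*n x n) (trans (cong (λ k → x % n + k * n) eq) (+-identityʳ _))
    [x+n] : (x + 1 * n) % (n ^ 2) ≡ x + 1 * n
    [x+n] = m<n⇒m%n≡m (r+kn<n² (subst (_< n) (sym x≡x%n) (m%n<n x n)) 1<n)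
  ... | suc a = n ∸ suc a , ∸-monoʳ-< (s≤s z≤n) (<⇒≤ 1+a<n)
              , trans (cong (λ z → z % n) x%n) (m%n%n≡m%n x n)
              , cong positive (trans (cong (λ z → z / n) x%n) (m<n⇒m/n≡0 (m%n<n x n)))
    where
    open ≡-Reasoning
    1+a<n : suc a < n
    1+a<n = subst (_< n) eq (x<n²⇒x/n<n x<n²)
    x%n : (x + (n ∸ suc a) * n) % (n ^ 2) ≡ x % n
    x%n = begin
      (x + (n ∸ suc a) * n) % (n ^ 2)                    ≡⟨ cong (λ z → (z + (n ∸ suc a) * n) % (n ^ 2)) (trans (m≡m%n+[m/n]*n x n) (cong (λ k → x % n + k * n) eq)) ⟩
      (x % n + suc a * n + (n ∸ suc a) * n) % (n ^ 2)    ≡⟨ cong (_% (n ^ 2)) (+-assoc (x % n) _ _) ⟩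
      (x % n + (suc a * n + (n ∸ suc a) * n)) % (n ^ 2)  ≡⟨ cong (λ z → (x % n + z) % (n ^ 2)) (*-distribʳ-+ n (suc a) (n ∸ suc a)) ⟨
      (x % n + (suc a + (n ∸ suc a)) * n) % (n ^ 2)      ≡⟨ cong (λ z → (x % n + z * n) % (n ^ 2)) (m+[n∸m]≡n (<⇒≤ 1+a<n)) ⟩
      (x % n + n * n) % (n ^ 2)                          ≡⟨ cong (λ z → (x % n + z) % (n ^ 2)) n²≡n*n ⟨
      (x % n + n ^ 2) % (n ^ 2)                          ≡⟨ [m+n]%n≡m%n (x % n) (n ^ 2) ⟩
      x % n % (n ^ 2)                                    ≡⟨ m<n⇒m%n≡m (<-≤-trans (m%n<n x n) (subst (n ≤_) (sym n²≡n*n) (m≤m*n n n))) ⟩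
      x % n                                              ∎

-- The tiling of ℤ_M

module Lift {d : ℕ} (p : Fin d → ℕ) (prime : ∀ j → Prime (p j)) (p-injective : Injective _≡_ _≡_ p)
            (T : TwinFreeTiling d) where

  open Cube p
  open Coordinates p prime p-injective
  open TwinFreeTiling T

  p>1 : ∀ j → 1 < p j
  p>1 j = nonTrivial⇒n>1 (p j) {{prime⇒nonTrivial (prime j)}}

  private module C j = Circle (p j) (p>1 j)

  wordOf : (Fin d → ℕ) → Word d
  wordOf x = tabulate (λ j → C.wordDigit j (x j))

  pointOf : (Fin d → ℕ) → Point d
  pointOf y = tabulate (λ j → C.pointDigit j (y j))

  HalfShifted : (Fin d → ℕ) → Set
  HalfShifted x = ∀ j → x j % p j ≤ 1

  record Corner (x : Fin d → ℕ) : Set where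
    constructor corner
    field
      shifted : HalfShifted x
      tiled   : tile (wordOf x) ≡ true

  -- `wordOf` sees only whether a residue modulo `p j` is positive, so the first conjunct has to pin
  -- the residue to 0 or 1.
  A : Fin M → Bool
  A a = ⌊ all? (λ j → χ (toℕ a) j % p j ≤? 1) ⌋ ∧ tile (wordOf (χ (toℕ a)))

  A⇒corner : ∀ {a} → A a ≡ true → Corner (χ (toℕ a))
  A⇒corner {a} a∈ with all? (λ j → χ (toℕ a) j % p j ≤? 1)
  ... | yes h = corner h a∈

  corner⇒A : ∀ {a} → Corner (χ (toℕ a)) → A a ≡ true
  corner⇒A {a} (corner h t) with all? (λ j → χ (toℕ a) j % p j ≤? 1)
  ... | yes _ = t
  ... | no ¬h = contradiction h ¬h

  corner-cong : ∀ {x x′} → (∀ j → x j ≡ x′ j) → Corner x → Corner x′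
  corner-cong eq (corner h t) = corner
    (λ j → subst (λ z → z % p j ≤ 1) (eq j) (h j))
    (subst (λ w → tile w ≡ true) (tabulate-cong (λ j → cong (C.wordDigit j) (eq j))) t)

  residue : ℕ → Fin M
  residue a = fromℕ< (m%n<n a M)

  toℕ-residue : ∀ a → toℕ (residue a) % M ≡ a % M
  toℕ-residue a = trans (cong (_% M) (toℕ-fromℕ< (m%n<n a M))) (m%n%n≡m%n a M)

  χ-residue : ∀ a j → χ (toℕ (residue a)) j ≡ χ a j
  χ-residue a = χ-cong (toℕ (residue a)) a (toℕ-residue a)

  toℕ-%-injective : ∀ {a b : Fin M} → toℕ a % M ≡ toℕ b % M → a ≡ b
  toℕ-%-injective {a} {b} eq = toℕ-injective
    (trans (sym (m<n⇒m%n≡m (toℕ<n a))) (trans eq (m<n⇒m%n≡m (toℕ<n b))))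

  -- A word containing the point of `x` chooses a shift in each direction. Each coordinate of `x` is
  -- then the start of its interval plus an offset below `p j`; the starts give `a` and the offsets
  -- give `b`.
  cover-torus : (x : Fin M) → Σ (Fin M) λ a → Σ (Fin M) λ b →
    (A a ≡ true) × InB b × (toℕ a + toℕ b ≡ toℕ x [mod M ])
  cover-torus x with cover (pointOf (χ (toℕ x)))
  ... | w , w∈ , w∋x = residue α , residue β
                     , corner⇒A {residue α} (corner-cong (sym ∘ χ-a) start-corner)
                     , (offset , %⇒mod {a = toℕ (residue β)} {β} (toℕ-residue β))
                     , %⇒mod {a = toℕ (residue α) + toℕ (residue β)} {toℕ x} (χ-injective _ (toℕ x) χ-sum)
    where
    open ≡-Reasoning
    y : Fin d → ℕ
    y = χ (toℕ x)

    s : Fin d → Bool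
    s j = proj₁ (lookup w j)

    start : Fin d → ℕ
    start j = C.start j (s j) (y j)

    offset : ∀ j → Fin (p j)
    offset j = fromℕ< (m%n<n (C.back j (s j) (y j)) (p j))

    α β : ℕ
    α = ∑ (λ j → start j * Mj j)
    β = ∑ (λ j → toℕ (offset j) * Mj j)

    χ-a : ∀ j → χ (toℕ (residue α)) j ≡ start j
    χ-a j = begin
      χ (toℕ (residue α)) j  ≡⟨ χ-residue α j ⟩
      χ α j                  ≡⟨ χ-∑ start j ⟩
      start j % q j          ≡⟨ m<n⇒m%n≡m (C.start<n² j (s j) (y j)) ⟩
      start j                ∎

    wordOf-start : wordOf start ≡ w
    wordOf-start = trans (tabulate-cong digit-start) (tabulate∘lookup w)
      where
      digit-start : ∀ j → C.wordDigit j (start j) ≡ lookup w j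
      -- Containment says exactly that the level prescribed by `w` is the level of the interval
      -- found around `y j`.
      digit-start j = trans (C.wordDigit-start j (s j) (y j)) (cong (s j ,_)
        (trans (C.pointDigit-if j (s j) (y j)) (sym (subst (lookup w j ∋_)
          (lookup∘tabulate (λ j → C.pointDigit j (y j)) j) (Pointwise.lookup w∋x j)))))

    start-corner : Corner start
    start-corner = corner (λ j → C.start%n≤1 j (s j) (y j))
      (subst (λ w → tile w ≡ true) (sym wordOf-start) w∈)

    χ-sum : ∀ j → χ (toℕ (residue α) + toℕ (residue β)) j ≡ y j
    χ-sum j = begin
      χ (toℕ (residue α) + toℕ (residue β)) j                ≡⟨ χ-+ (toℕ (residue α)) (toℕ (residue β)) j ⟩
      (χ (toℕ (residue α)) j + χ (toℕ (residue β)) j) % q j  ≡⟨ cong₂ (λ u v → (u + v) % q j) (χ-a j) (trans (χ-residue β j) (χ-∑ (toℕ ∘ offset) j)) ⟩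
      (start j + toℕ (offset j) % q j) % q j                 ≡⟨ cong (_% q j) (+-comm (start j) _) ⟩
      (toℕ (offset j) % q j + start j) % q j                 ≡⟨ %-congˡ-+ (toℕ (offset j) % q j) (toℕ (offset j)) (start j) (q j) (m%n%n≡m%n (toℕ (offset j)) (q j)) ⟩
      (toℕ (offset j) + start j) % q j                       ≡⟨ cong (_% q j) (+-comm (toℕ (offset j)) _) ⟩
      (start j + toℕ (offset j)) % q j                       ≡⟨ cong (λ z → (start j + z) % q j) (toℕ-fromℕ< _) ⟩
      (start j + C.back j (s j) (y j) % p j) % q j           ≡⟨ C.start-back j (s j) (y j) ⟩
      y j % q j                                              ≡⟨ χ-% (toℕ x) j ⟩
      y j                                                    ∎

  -- A solution is determined by `x` and the shifts of `a`, and the word of `a` contains the point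
  -- of `x`.
  module Solution {x a b : Fin M} (a∈ : A a ≡ true) (b∈ : InB b)
                  (a+b≡x : toℕ a + toℕ b ≡ toℕ x [mod M ]) where
    open ≡-Reasoning

    offset : ∀ j → Fin (p j)
    offset = proj₁ b∈

    half : HalfShifted (χ (toℕ a))
    half = Corner.shifted (A⇒corner {a} a∈)

    tiled : tile (wordOf (χ (toℕ a))) ≡ true
    tiled = Corner.tiled (A⇒corner {a} a∈)

    χ-b : ∀ j → χ (toℕ b) j ≡ toℕ (offset j) % q j
    χ-b j = trans
      (χ-cong (toℕ b) (∑ (λ k → toℕ (offset k) * Mj k)) (mod⇒% {a = toℕ b} {∑ (λ k → toℕ (offset k) * Mj k)} (proj₂ b∈)) j)
      (χ-∑ (toℕ ∘ offset) j)

    sum : ∀ j → (χ (toℕ a) j + toℕ (offset j)) % q j ≡ χ (toℕ x) j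
    sum j = begin
      (χ (toℕ a) j + toℕ (offset j)) % q j        ≡⟨ cong (_% q j) (+-comm (χ (toℕ a) j) _) ⟩
      (toℕ (offset j) + χ (toℕ a) j) % q j        ≡⟨ %-congˡ-+ (toℕ (offset j)) (toℕ (offset j) % q j) (χ (toℕ a) j) (q j) (sym (m%n%n≡m%n (toℕ (offset j)) (q j))) ⟩
      (toℕ (offset j) % q j + χ (toℕ a) j) % q j  ≡⟨ cong (λ z → (z + χ (toℕ a) j) % q j) (χ-b j) ⟨
      (χ (toℕ b) j + χ (toℕ a) j) % q j           ≡⟨ cong (_% q j) (+-comm (χ (toℕ b) j) _) ⟩
      (χ (toℕ a) j + χ (toℕ b) j) % q j           ≡⟨ χ-+ (toℕ a) (toℕ b) j ⟨
      χ (toℕ a + toℕ b) j                         ≡⟨ χ-cong (toℕ a + toℕ b) (toℕ x) (mod⇒% {a = toℕ a + toℕ b} {toℕ x} a+b≡x) j ⟩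
      χ (toℕ x) j                                 ∎

    s : Fin d → Bool
    s j = positive (χ (toℕ a) j % p j)

    χ-a≡start : ∀ j → χ (toℕ a) j ≡ C.start j (s j) (χ (toℕ x) j)
    χ-a≡start j = C.start-unique j (χ-< (toℕ a) j) (half j) (toℕ<n (offset j)) (sum j)

    offset≡ : ∀ j → toℕ (offset j) ≡ C.back j (s j) (χ (toℕ x) j) % p j
    offset≡ j = C.offset-unique j (χ-< (toℕ a) j) (half j) (toℕ<n (offset j)) (sum j)

    contains : Contains (wordOf (χ (toℕ a))) (pointOf (χ (toℕ x)))
    contains = tabulate⁺ (λ j → C.wordDigit-∋ j (χ-< (toℕ a) j) (half j) (toℕ<n (offset j)) (sum j))

  -- Both words contain the point of `x`, so they coincide. Hence the shifts agree, and these
  -- determine the solution.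
  unique-torus : (x a b a' b' : Fin M) →
    A a ≡ true → InB b → toℕ a + toℕ b ≡ toℕ x [mod M ] →
    A a' ≡ true → InB b' → toℕ a' + toℕ b' ≡ toℕ x [mod M ] →
    (a ≡ a') × (b ≡ b')
  unique-torus x a b a' b' a∈ b∈ eq a'∈ b'∈ eq' =
      toℕ-%-injective (χ-injective (toℕ a) (toℕ a') (λ j →
        trans (S.χ-a≡start j) (trans (cong (λ s → C.start j s (χ (toℕ x) j)) (s≡s' j)) (sym (S'.χ-a≡start j)))))
    , toℕ-%-injective (χ-injective (toℕ b) (toℕ b') (λ j →
        trans (S.χ-b j) (trans (cong (_% q j) (offset≡offset' j)) (sym (S'.χ-b j)))))
    where
    module S  = Solution {x} {a}  {b}  a∈  b∈  eq
    module S' = Solution {x} {a'} {b'} a'∈ b'∈ eq'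

    s≡s' : ∀ j → S.s j ≡ S'.s j
    s≡s' j = cong proj₁ (begin
      C.wordDigit j (χ (toℕ a) j)     ≡⟨ lookup∘tabulate _ j ⟨
      lookup (wordOf (χ (toℕ a))) j   ≡⟨ cong (λ w → lookup w j) (unique S.tiled S'.tiled S.contains S'.contains) ⟩
      lookup (wordOf (χ (toℕ a'))) j  ≡⟨ lookup∘tabulate _ j ⟩
      C.wordDigit j (χ (toℕ a') j)    ∎)
      where open ≡-Reasoning

    offset≡offset' : ∀ j → toℕ (S.offset j) ≡ toℕ (S'.offset j)
    offset≡offset' j = trans (S.offset≡ j)
      (trans (cong (λ s → C.back j s (χ (toℕ x) j) % p j) (s≡s' j)) (sym (S'.offset≡ j)))

  -- Moving along the fiber by the step `k` of `opposite` changes the level in direction `i` and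
  -- nothing else in the word, so the two elements have twin words.
  no-fiber : (u : Fin M) (i : Fin d) → A u ≡ true → ¬ TranslateOfFiberIn A u i
  no-fiber u i u∈ fiber with C.opposite i (χ-< (toℕ u) i)
  ... | k , k<n , same , opp = twin-free i (Corner.tiled (A⇒corner {u} u∈))
        (subst (λ w → tile w ≡ true) wordOf-y (Corner.tiled (A⇒corner {y} y∈)))
    where
    open ≡-Reasoning
    k′ : Fin (p i)
    k′ = fromℕ< k<n

    v : ℕ
    v = toℕ u + toℕ k′ * M/p i

    y : Fin M
    y = residue v

    y∈ : A y ≡ true
    y∈ = fiber k′ y (%⇒mod {a = toℕ y} {v} (toℕ-residue v))

    -- Written as a multiple of `Mj i`, the translation adds `k * p i` to coordinate `i` and 0 to
    -- the others.
    step : toℕ k′ * M/p i ≡ toℕ k′ * p i * Mj i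
    step = trans (cong (toℕ k′ *_) (*-comm (Mj i) (p i))) (sym (*-assoc (toℕ k′) (p i) (Mj i)))

    χ-y : ∀ j → χ (toℕ y) j ≡ (χ (toℕ u) j + χ (toℕ k′ * p i * Mj i) j) % q j
    χ-y j = trans (χ-residue v j) (trans (χ-+ (toℕ u) (toℕ k′ * M/p i) j)
      (cong (λ z → (χ (toℕ u) j + χ z j) % q j) step))

    χ-y-i : χ (toℕ y) i ≡ (χ (toℕ u) i + k * p i) % q i
    χ-y-i = begin
      χ (toℕ y) i                                      ≡⟨ χ-y i ⟩
      (χ (toℕ u) i + χ (toℕ k′ * p i * Mj i) i) % q i  ≡⟨ cong (λ z → (χ (toℕ u) i + z) % q i) (χ-*Mj (toℕ k′ * p i) i) ⟩
      (χ (toℕ u) i + toℕ k′ * p i % q i) % q i         ≡⟨ cong (λ z → (χ (toℕ u) i + z * p i % q i) % q i) (toℕ-fromℕ< k<n) ⟩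
      (χ (toℕ u) i + k * p i % q i) % q i              ≡⟨ cong (_% q i) (+-comm (χ (toℕ u) i) _) ⟩
      (k * p i % q i + χ (toℕ u) i) % q i              ≡⟨ %-congˡ-+ (k * p i % q i) (k * p i) (χ (toℕ u) i) (q i) (m%n%n≡m%n (k * p i) (q i)) ⟩
      (k * p i + χ (toℕ u) i) % q i                    ≡⟨ cong (_% q i) (+-comm (k * p i) _) ⟩
      (χ (toℕ u) i + k * p i) % q i                    ∎

    χ-y-≢ : ∀ {j} → j ≢ i → χ (toℕ y) j ≡ χ (toℕ u) j
    χ-y-≢ {j} j≢i = begin
      χ (toℕ y) j                                      ≡⟨ χ-y j ⟩
      (χ (toℕ u) j + χ (toℕ k′ * p i * Mj i) j) % q j  ≡⟨ cong (λ z → (χ (toℕ u) j + z) % q j) (χ-*Mj-≢ (toℕ k′ * p i) j≢i) ⟩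
      (χ (toℕ u) j + 0) % q j                          ≡⟨ cong (_% q j) (+-identityʳ (χ (toℕ u) j)) ⟩
      χ (toℕ u) j % q j                                ≡⟨ χ-% (toℕ u) j ⟩
      χ (toℕ u) j                                      ∎

    digit-y : ∀ j → C.wordDigit j (χ (toℕ y) j) ≡ lookup (flip i (wordOf (χ (toℕ u)))) j
    digit-y j with j ≟ i
    ... | yes refl = begin
      C.wordDigit i (χ (toℕ y) i)                    ≡⟨ cong (C.wordDigit i) χ-y-i ⟩
      C.wordDigit i ((χ (toℕ u) i + k * p i) % q i)  ≡⟨ cong₂ _,_ (cong positive same) opp ⟩
      map₂ not (C.wordDigit i (χ (toℕ u) i))         ≡⟨ cong (map₂ not) (lookup∘tabulate _ i) ⟨
      map₂ not (lookup (wordOf (χ (toℕ u))) i)       ≡⟨ lookup∘updateAt i (wordOf (χ (toℕ u))) ⟨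
      lookup (flip i (wordOf (χ (toℕ u)))) i         ∎
    ... | no j≢i = begin
      C.wordDigit j (χ (toℕ y) j)             ≡⟨ cong (C.wordDigit j) (χ-y-≢ j≢i) ⟩
      C.wordDigit j (χ (toℕ u) j)             ≡⟨ lookup∘tabulate _ j ⟨
      lookup (wordOf (χ (toℕ u))) j           ≡⟨ lookup∘updateAt′ j i j≢i (wordOf (χ (toℕ u))) ⟨
      lookup (flip i (wordOf (χ (toℕ u)))) j  ∎

    wordOf-y : wordOf (χ (toℕ y)) ≡ flip i (wordOf (χ (toℕ u)))
    wordOf-y = trans (tabulate-cong digit-y) (tabulate∘lookup (flip i (wordOf (χ (toℕ u)))))

  cubeTiling : Σ (Fin M → Bool) λ A → Tiling A × ((u : Fin M) (i : Fin d) → A u ≡ true → ¬ TranslateOfFiberIn A u i)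
  cubeTiling = A , (cover-torus , unique-torus) , no-fiber

theorem1p7 : (d : ℕ) → 8 ≤ d → (p : Fin d → ℕ) → ((j : Fin d) → Prime (p j)) → Injective _≡_ _≡_ p →
    Σ (Fin (Cube.M p) → Bool) λ A →
    Cube.Tiling p A ×
    ((u : Fin (Cube.M p)) (i : Fin d) → A u ≡ true → ¬ Cube.TranslateOfFiberIn p A u i)
theorem1p7 d 8≤d p prime p-injective = Lift.cubeTiling p prime p-injective
  -- Layering twists coordinate zero, so its dimensions have the form `suc (k + m)`; here `m` is 7
  -- and `k` is `d ∸ 8`, which gives `d` because `8 ≤ d`.
  (subst TwinFreeTiling (trans (sym (+-suc (d ∸ 8) 7)) (m∸n+n≡m 8≤d)) (layers^ (d ∸ 8) tiling₈))
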